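{- Let $(G,s,t)$ be an oriented serial superedge with principal subgraphs $(G_1,s_1,t_1),\dots,(G_k,s_k,t_k)$ (so $s_1=s$, $t_i=s_{i+1}$, $t_k=t$), each $G_i$ non-parallel. For each $i$ let $\mathcal{T}_i$ contain exactly one spanning tree from each orbit of $\mathsf{ST}(G_i)$ under $\mathrm{Aut}_{\mathrm{or}}(G_i,s_i,t_i)$, and let $\mathcal{N}_i$ contain exactly one near tree from each orbit of $\mathsf{NT}(G_i)$ under $\mathrm{Aut}_{\mathrm{or}}(G_i,s_i,t_i)$. Then the set of all subgraphs $F_1\cup\dots\cup F_k$ such that, for some $j\in\{1,\dots,k\}$, $F_j\in\mathcal{N}_j$ and $F_i\in\mathcal{T}_i$ for all $i\neq j$, consists of near trees of $G$ and contains exactly one near tree from each orbit of $\mathsf{NT}(G)$ under $\mathrm{Aut}_{\mathrm{or}}(G,s,t)$.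
   Context: All graphs are finite, simple and undirected. An oriented series-parallel graph is a triple $(G,s,t)$ where $G$ is a graph and $s\neq t$ are vertices, defined recursively: (i) $G$ is a single edge with vertex set $\{s,t\}$; or (ii) (serial superedge) there are $k\ge 2$ oriented series-parallel graphs $(G_1,s_1,t_1),\dots,(G_k,s_k,t_k)$ with $s_1=s$, $t_k=t$, $t_i=s_{i+1}$ for $1\le i<k$, $V(G_i)\cap V(G_{i+1})=\{s_{i+1}\}$, $V(G_i)\cap V(G_j)=\emptyset$ for $|i-j|\ge2$, and $G=G_1\cup\dots\cup G_k$; or (iii) (parallel superedge) there are $k\ge2$ oriented series-parallel graphs $(G_1,s,t),\dots,(G_k,s,t)$ with $V(G_i)\cap V(G_j)=\{s,t\}$ for $i\neq j$ and $G=G_1\cup\dots\cup G_k$. The $G_i$ are the principal subgraphs. A graph is non-parallel if it is not a parallel superedge. For an oriented series-parallel graph $(H,u,v)$, $\mathrm{Aut}_{\mathrm{or}}(H,u,v)$ is the group of automorphisms of $H$ fixing $u$ and $v$, acting on subgraphs of $H$; $\mathsf{ST}(H)$ is the set of spanning trees of $H$; a near tree of $H$ is a spanning subgraph obtained from a spanning tree of $H$ by deleting one edge (equivalently an acyclic spanning subgraph with $|V(H)|-2$ edges), and $\mathsf{NT}(H)$ is the set of near trees. Two subgraphs $A,B$ are in the same orbit iff $A=\sigma(B)$ for some $\sigma$ in the group. -}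

module Defs where

open import Data.Empty using (⊥-elim-irr)
open import Data.Fin using (Fin; zero; suc; toℕ; fromℕ; inject₁)
open import Data.Fin.Permutation using (Permutation′; _⟨$⟩ʳ_; _⟨$⟩ˡ_)
open import Data.Fin.Properties using (any?; _≟_)
open import Data.Fin.Subset using (Subset; _∈_; _∉_; _⊆_; _∩_; _∪_; ⊥; ⁅_⁆)
open import Data.Fin.Subset.Properties using (_∈?_)
open import Data.Nat using (ℕ; _+_; _≤_; ∣_-_∣)
open import Data.Product using (Σ; ∃; ∃-syntax; ∃!; _×_; _,_)
open import Data.Sum using (_⊎_; inj₁; inj₂)
open import Data.Vec using (Vec; tabulate; lookup)
open import Data.Vec.Properties using (lookup∘tabulate; []=⇒lookup; lookup⇒[]=)
open import Function using (_⇔_; _∘_)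
open import Level using (0ℓ)
open import Relation.Binary.Construct.Closure.ReflexiveTransitive using (Star)
open import Relation.Binary.PropositionalEquality
  using (_≡_; _≢_; refl; sym; trans; subst)
open import Relation.Nullary using (¬_; Dec; does; yes; no; _×-dec_; _⊎-dec_; ¬?)
open import Relation.Nullary.Decidable using (dec-true; recompute)
open import Relation.Unary using (Pred)
import Relation.Unary as U
import Relation.Binary as B

private
  variable
    n m : ℕ

-- Finite simple graphs whose vertices are drawn from a common pool Fin n, so
-- that unions and intersections of different graphs make sense; vertices G
-- need not be the whole pool.  The adjacency matrix is a vector and the laws
-- are irrelevant, so _≡_ on Graph n is equality of vertex and edge sets.
record Graph (n : ℕ) : Set where
  constructor graph
  field
    vertices   : Subset n
    neighbours : Vec (Subset n) n

  Adj : Fin n → Fin n → Set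
  Adj x y = y ∈ lookup neighbours x

  field
    .adj-sym    : ∀ {x y} → Adj x y → Adj y x
    .adj-irrefl : ∀ {x} → ¬ Adj x x
    .adj-vertex : ∀ {x y} → Adj x y → x ∈ vertices

open Graph public using (vertices; neighbours; Adj)

Adj? : (G : Graph n) → B.Decidable (Adj G)
Adj? G x y = y ∈? lookup (neighbours G) x

adj-sym : (G : Graph n) → ∀ {x y} → Adj G x y → Adj G y x
adj-sym G@(graph _ _ G-sym _ _) {x} {y} a = recompute (Adj? G y x) (G-sym a)

adj-irrefl : (G : Graph n) → ∀ {x} → ¬ Adj G x x
adj-irrefl (graph _ _ _ G-irrefl _) a = ⊥-elim-irr (G-irrefl a)

adj-vertex : (G : Graph n) → ∀ {x y} → Adj G x y → x ∈ vertices G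
adj-vertex G@(graph _ _ _ _ G-vertex) {x} a =
  recompute (x ∈? vertices G) (G-vertex a)

⟪_⟫ : {P : Pred (Fin n) 0ℓ} → U.Decidable P → Subset n
⟪ P? ⟫ = tabulate (does ∘ P?)

∈⟪⟫⁺ : {P : Pred (Fin n) 0ℓ} (P? : U.Decidable P) → ∀ {x} → P x → x ∈ ⟪ P? ⟫
∈⟪⟫⁺ P? {x} p =
  lookup⇒[]= x _ (trans (lookup∘tabulate (does ∘ P?) x) (dec-true (P? x) p))

∈⟪⟫⁻ : {P : Pred (Fin n) 0ℓ} (P? : U.Decidable P) → ∀ {x} → x ∈ ⟪ P? ⟫ → P x
∈⟪⟫⁻ P? {x} q
  with P? x | trans (sym (lookup∘tabulate (does ∘ P?) x)) ([]=⇒lookup q)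
... | yes p | _  = p
... | no _  | ()

module _ {P : Pred (Fin n) 0ℓ} {R : B.Rel (Fin n) 0ℓ}
         (P? : U.Decidable P) (R? : B.Decidable R) where

  private
    rows : Vec (Subset n) n
    rows = tabulate λ x → ⟪ R? x ⟫

  row⁺ : ∀ {x y} → R x y → y ∈ lookup rows x
  row⁺ {x} {y} r =
    subst (y ∈_) (sym (lookup∘tabulate (λ x → ⟪ R? x ⟫) x)) (∈⟪⟫⁺ (R? x) r)

  row⁻ : ∀ {x y} → y ∈ lookup rows x → R x y
  row⁻ {x} {y} q =
    ∈⟪⟫⁻ (R? x) (subst (y ∈_) (lookup∘tabulate (λ x → ⟪ R? x ⟫) x) q)

  mkGraph : .(∀ {x y} → R x y → R y x) → .(∀ {x} → ¬ R x x) →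
            .(∀ {x y} → R x y → P x) → Graph n
  mkGraph R-sym R-irrefl R-vertex = graph ⟪ P? ⟫ rows
    (λ q → row⁺ (R-sym (row⁻ q)))
    (λ q → R-irrefl (row⁻ q))
    (λ q → ∈⟪⟫⁺ P? (R-vertex (row⁻ q)))

⋃ : (Fin m → Graph n) → Graph n
⋃ F = mkGraph
  (λ x → any? λ i → x ∈? vertices (F i))
  (λ x y → any? λ i → Adj? (F i) x y)
  (λ (i , a) → i , adj-sym (F i) a)
  (λ (i , a) → adj-irrefl (F i) a)
  (λ (i , a) → i , adj-vertex (F i) a)

image : Permutation′ n → Graph n → Graph n
image σ G = mkGraph
  (λ x → (σ ⟨$⟩ˡ x) ∈? vertices G)
  (λ x y → Adj? G (σ ⟨$⟩ˡ x) (σ ⟨$⟩ˡ y))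
  (adj-sym G)
  (adj-irrefl G)
  (adj-vertex G)

SameEdge : (x y x′ y′ : Fin n) → Set
SameEdge x y x′ y′ = (x ≡ x′ × y ≡ y′) ⊎ (x ≡ y′ × y ≡ x′)

sameEdge? : (x y x′ y′ : Fin n) → Dec (SameEdge x y x′ y′)
sameEdge? x y x′ y′ = (x ≟ x′ ×-dec y ≟ y′) ⊎-dec (x ≟ y′ ×-dec y ≟ x′)

deleteEdge : Graph n → (u v : Fin n) → Graph n
deleteEdge G u v = mkGraph
  (λ x → x ∈? vertices G)
  (λ x y → Adj? G x y ×-dec ¬? (sameEdge? x y u v))
  (λ (a , ne) → adj-sym G a , λ
    { (inj₁ (p , q)) → ne (inj₂ (q , p))
    ; (inj₂ (p , q)) → ne (inj₁ (q , p)) })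
  (λ (a , _) → adj-irrefl G a)
  (λ (a , _) → adj-vertex G a)

------------------------------------------------------------------------
-- Oriented series-parallel graphs

record IsSerialComposition (G : Graph n) (s t : Fin n)
         (Gs : Fin (2 + m) → Graph n) (ss ts : Fin (2 + m) → Fin n) : Set where
  field
    source      : ss zero ≡ s
    target      : ts (fromℕ (1 + m)) ≡ t
    glue        : ∀ (i : Fin (1 + m)) → ts (inject₁ i) ≡ ss (suc i)
    consecutive : ∀ (i : Fin (1 + m)) →
                  vertices (Gs (inject₁ i)) ∩ vertices (Gs (suc i)) ≡ ⁅ ss (suc i) ⁆
    distant     : ∀ i j → 2 ≤ ∣ toℕ i - toℕ j ∣ →
                  vertices (Gs i) ∩ vertices (Gs j) ≡ ⊥
    union       : G ≡ ⋃ Gs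

-- Since graphs are simple, distinct parts of a parallel composition must not
-- share the edge st.  Without edge-disjoint, a single edge would also be the
-- parallel composition of two copies of itself.
record IsParallelComposition (G : Graph n) (s t : Fin n)
         (Gs : Fin (2 + m) → Graph n) : Set where
  field
    common        : ∀ i j → i ≢ j →
                    vertices (Gs i) ∩ vertices (Gs j) ≡ ⁅ s ⁆ ∪ ⁅ t ⁆
    edge-disjoint : ∀ i j → i ≢ j → ∀ {x y} → Adj (Gs i) x y → ¬ Adj (Gs j) x y
    union         : G ≡ ⋃ Gs

data SeriesParallel {n : ℕ} (G : Graph n) (s t : Fin n) : Set where
  edge     : s ≢ t → vertices G ≡ ⁅ s ⁆ ∪ ⁅ t ⁆ → Adj G s t →
             SeriesParallel G s t
  serial   : ∀ {m} (Gs : Fin (2 + m) → Graph n) (ss ts : Fin (2 + m) → Fin n) →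
             IsSerialComposition G s t Gs ss ts →
             (∀ i → SeriesParallel (Gs i) (ss i) (ts i)) →
             SeriesParallel G s t
  parallel : ∀ {m} (Gs : Fin (2 + m) → Graph n) →
             IsParallelComposition G s t Gs →
             (∀ i → SeriesParallel (Gs i) s t) →
             SeriesParallel G s t

record IsSerialSuperedge (G : Graph n) (s t : Fin n)
         (Gs : Fin (2 + m) → Graph n) (ss ts : Fin (2 + m) → Fin n) : Set where
  field
    composition : IsSerialComposition G s t Gs ss ts
    parts       : ∀ i → SeriesParallel (Gs i) (ss i) (ts i)

IsParallelSuperedge : Graph n → Fin n → Fin n → Set
IsParallelSuperedge {n} G s t =
  ∃[ m ] Σ (Fin (2 + m) → Graph n) λ Gs →
    IsParallelComposition G s t Gs × (∀ i → SeriesParallel (Gs i) s t)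

NonParallel : Graph n → Fin n → Fin n → Set
NonParallel G s t = ¬ IsParallelSuperedge G s t

------------------------------------------------------------------------
-- Spanning trees and near trees

record IsSubgraph (A H : Graph n) : Set where
  field
    vertices-⊆ : vertices A ⊆ vertices H
    adj-⊆      : ∀ {x y} → Adj A x y → Adj H x y

Connected : Graph n → Set
Connected G = ∀ {x y} → x ∈ vertices G → y ∈ vertices G → Star (Adj G) x y

record Cycle (G : Graph n) : Set where
  field
    {extra}  : ℕ
    vertex   : Fin (3 + extra) → Fin n
    distinct : ∀ {i j} → vertex i ≡ vertex j → i ≡ j
    step     : ∀ (i : Fin (2 + extra)) → Adj G (vertex (inject₁ i)) (vertex (suc i))
    close    : Adj G (vertex (fromℕ (2 + extra))) (vertex zero)

Acyclic : Graph n → Set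
Acyclic G = ¬ Cycle G

record ST (H T : Graph n) : Set where
  field
    subgraph  : IsSubgraph T H
    spanning  : vertices T ≡ vertices H
    connected : Connected T
    acyclic   : Acyclic T

NT : (H N : Graph n) → Set
NT H N = ∃[ T ] ST H T × ∃[ x ] ∃[ y ] Adj T x y × N ≡ deleteEdge T x y

------------------------------------------------------------------------
-- Automorphisms and orbits

-- A permutation of V(H) is encoded as its extension by the identity to a
-- permutation of the vertex pool.
record Autₒᵣ (H : Graph n) (u v : Fin n) : Set where
  field
    perm         : Permutation′ n
    fix-outside  : ∀ {x} → x ∉ vertices H → perm ⟨$⟩ʳ x ≡ x
    preserve-adj : ∀ {x y} → Adj H x y ⇔ Adj H (perm ⟨$⟩ʳ x) (perm ⟨$⟩ʳ y)
    fix-u        : perm ⟨$⟩ʳ u ≡ u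
    fix-v        : perm ⟨$⟩ʳ v ≡ v

SameOrbit : (H : Graph n) (u v : Fin n) → Graph n → Graph n → Set
SameOrbit H u v A B = Σ (Autₒᵣ H u v) λ σ → A ≡ image (Autₒᵣ.perm σ) B

record ExactlyOnePerOrbit (H : Graph n) (u v : Fin n)
         (𝒫 𝒮 : Pred (Graph n) 0ℓ) : Set where
  field
    consists-of : 𝒮 U.⊆ 𝒫
    exactly-one : ∀ A → 𝒫 A → ∃! _≡_ λ B → 𝒮 B × SameOrbit H u v A B

OneNearTreeUnions : (𝒯 𝒩 : Fin m → Pred (Graph n) 0ℓ) → Pred (Graph n) 0ℓ
OneNearTreeUnions {m} {n} 𝒯 𝒩 X =
  ∃[ j ] Σ (Fin m → Graph n) λ F →
    𝒩 j (F j) × (∀ i → i ≢ j → 𝒯 i (F i)) × X ≡ ⋃ F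

{-# OPTIONS --safe #-}
module Submission where

-- The automorphisms of G fixing s and t are exactly the products of such
-- automorphisms of the parts.  For this, let c be one of the gluing vertices.
-- The side of c towards t is connected and, in a series-parallel graph, stays
-- connected to t when c is deleted; an automorphism fixing t cannot move c out of
-- that side, as its inverse would then map the side into a proper subset of itself.
-- The same holds towards s, so c is fixed, hence so are both sides and each part.
--
-- Spanning trees also decompose along the parts: retracting G onto a part
-- contracts every other part to a vertex, so it turns connecting walks, and walks
-- that close a cycle with a given edge, into such walks inside the part.
-- A near tree of G misses one tree edge in just one part, namely the only
-- part in which it is disconnected.

open import Data.Fin using (Fin; zero; suc; toℕ; fromℕ; inject₁; _<_; _>_)
open import Data.Fin.Induction using (<-weakInduction; >-weakInduction)
open import Data.Fin.Permutation
  using (Permutation′; _⟨$⟩ʳ_; _⟨$⟩ˡ_; inverseˡ; inverseʳ; permutation; flip)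
open import Data.Fin.Properties
  using (any?; _≟_; _<?_; <-cmp; <-trans; pigeonhole; toℕ-injective;
         toℕ-inject₁; suc-injective)
open import Data.Fin.Subset using (Subset; _∈_; _∉_)
open import Data.Fin.Subset.Properties
  using (_∈?_; ⊆-antisym; x∈⁅y⁆⇒x≡y; x∈p∩q⁺; x∈p∪q⁻; ∉⊥)
open import Data.Nat as ℕ using (ℕ; zero; suc; _+_; s≤s; ∣_-_∣)
open import Data.Nat.GeneralisedArithmetic using (fold)
import Data.Nat.Properties as ℕₚ
open import Data.Product using (Σ; ∃; ∃-syntax; _×_; _,_; proj₁; proj₂)
open import Data.Sum as Sum using (_⊎_; inj₁; inj₂)
open import Data.Vec using (tabulate)
open import Data.Vec.Functional using (updateAt)
open import Data.Vec.Functional.Properties using (updateAt-updates; updateAt-minimal)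
open import Data.Vec.Properties using (tabulate∘lookup; tabulate-cong)
open import Function using (_∘_; const; mk⇔; Equivalence)
open import Level using (0ℓ)
open import Relation.Binary using (Rel; Tri; Trichotomous; Transitive; tri<; tri≈; tri>)
open import Relation.Binary.Construct.Closure.ReflexiveTransitive as Star
  using (Star; ε; _◅_; _◅◅_)
open import Relation.Binary.PropositionalEquality
  using (_≡_; _≢_; refl; sym; trans; cong; subst; subst₂; ≢-sym)
open import Relation.Nullary using (¬_; Dec; yes; no; contradiction; _×-dec_; ¬?)
open import Relation.Nullary.Decidable using (decidable-stable)
open import Relation.Unary using (Pred; Decidable)
open import Defs

private
  variable
    n m k : ℕ
    x y : Fin n

-- Graph operations

module _ {A B : Graph n} where

  private
    graph-≡ : vertices A ≡ vertices B → neighbours A ≡ neighbours B → A ≡ B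
    graph-≡ refl refl = refl

  graph-ext : (∀ {x} → x ∈ vertices A → x ∈ vertices B) →
              (∀ {x} → x ∈ vertices B → x ∈ vertices A) →
              (∀ {x y} → Adj A x y → Adj B x y) →
              (∀ {x y} → Adj B x y → Adj A x y) → A ≡ B
  graph-ext v⊆ v⊇ e⊆ e⊇ = graph-≡ (⊆-antisym v⊆ v⊇)
    (trans (sym (tabulate∘lookup (neighbours A)))
      (trans (tabulate-cong λ x → ⊆-antisym (e⊆ {x}) (e⊇ {x}))
        (tabulate∘lookup (neighbours B))))

adj-vertexʳ : (G : Graph n) → Adj G x y → y ∈ vertices G
adj-vertexʳ G a = adj-vertex G (adj-sym G a)

adj-≢ : (G : Graph n) → Adj G x y → x ≢ y
adj-≢ G a refl = adj-irrefl G a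

module _ (F : Fin k → Graph n) where

  ⋃-vertex⁺ : ∀ i → x ∈ vertices (F i) → x ∈ vertices (⋃ F)
  ⋃-vertex⁺ i p = ∈⟪⟫⁺ (λ x → any? λ i → x ∈? vertices (F i)) (i , p)

  ⋃-vertex⁻ : x ∈ vertices (⋃ F) → ∃ λ i → x ∈ vertices (F i)
  ⋃-vertex⁻ = ∈⟪⟫⁻ (λ x → any? λ i → x ∈? vertices (F i))

  ⋃-adj⁺ : ∀ i → Adj (F i) x y → Adj (⋃ F) x y
  ⋃-adj⁺ i a = row⁺ (λ x → any? λ i → x ∈? vertices (F i))
                    (λ x y → any? λ i → Adj? (F i) x y) (i , a)

  ⋃-adj⁻ : Adj (⋃ F) x y → ∃ λ i → Adj (F i) x y
  ⋃-adj⁻ = row⁻ (λ x → any? λ i → x ∈? vertices (F i))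
                (λ x y → any? λ i → Adj? (F i) x y)

⋃-cong : {F F′ : Fin k → Graph n} → (∀ i → F i ≡ F′ i) → ⋃ F ≡ ⋃ F′
⋃-cong {F = F} {F′} eq = graph-ext
  (λ p → let i , q = ⋃-vertex⁻ F p in ⋃-vertex⁺ F′ i (subst (λ H → _ ∈ vertices H) (eq i) q))
  (λ p → let i , q = ⋃-vertex⁻ F′ p in ⋃-vertex⁺ F i (subst (λ H → _ ∈ vertices H) (sym (eq i)) q))
  (λ p → let i , q = ⋃-adj⁻ F p in ⋃-adj⁺ F′ i (subst (λ H → Adj H _ _) (eq i) q))
  (λ p → let i , q = ⋃-adj⁻ F′ p in ⋃-adj⁺ F i (subst (λ H → Adj H _ _) (sym (eq i)) q))

module _ (σ : Permutation′ n) (G : Graph n) where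

  image-vertex⁺ : σ ⟨$⟩ˡ x ∈ vertices G → x ∈ vertices (image σ G)
  image-vertex⁺ = ∈⟪⟫⁺ (λ x → (σ ⟨$⟩ˡ x) ∈? vertices G)

  image-vertex⁻ : x ∈ vertices (image σ G) → σ ⟨$⟩ˡ x ∈ vertices G
  image-vertex⁻ = ∈⟪⟫⁻ (λ x → (σ ⟨$⟩ˡ x) ∈? vertices G)

  image-adj⁺ : Adj G (σ ⟨$⟩ˡ x) (σ ⟨$⟩ˡ y) → Adj (image σ G) x y
  image-adj⁺ = row⁺ (λ x → (σ ⟨$⟩ˡ x) ∈? vertices G)
                    (λ x y → Adj? G (σ ⟨$⟩ˡ x) (σ ⟨$⟩ˡ y))

  image-adj⁻ : Adj (image σ G) x y → Adj G (σ ⟨$⟩ˡ x) (σ ⟨$⟩ˡ y)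
  image-adj⁻ = row⁻ (λ x → (σ ⟨$⟩ˡ x) ∈? vertices G)
                    (λ x y → Adj? G (σ ⟨$⟩ˡ x) (σ ⟨$⟩ˡ y))

  image-connected⁻ : Connected (image σ G) → Connected G
  image-connected⁻ conn x∈ y∈ = subst₂ (Star (Adj G)) (inverseˡ σ) (inverseˡ σ)
    (Star.gmap (σ ⟨$⟩ˡ_) image-adj⁻ (conn (lift x∈) (lift y∈)))
    where
    lift : x ∈ vertices G → σ ⟨$⟩ʳ x ∈ vertices (image σ G)
    lift p = image-vertex⁺ (subst (_∈ vertices G) (sym (inverseˡ σ)) p)

module _ (G : Graph n) (u v : Fin n) where

  delete-vertex⁺ : x ∈ vertices G → x ∈ vertices (deleteEdge G u v)
  delete-vertex⁺ = ∈⟪⟫⁺ (λ x → x ∈? vertices G)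

  delete-vertex⁻ : x ∈ vertices (deleteEdge G u v) → x ∈ vertices G
  delete-vertex⁻ = ∈⟪⟫⁻ (λ x → x ∈? vertices G)

  delete-adj⁺ : Adj G x y → ¬ SameEdge x y u v → Adj (deleteEdge G u v) x y
  delete-adj⁺ a ne = row⁺ (λ x → x ∈? vertices G)
    (λ x y → Adj? G x y ×-dec ¬? (sameEdge? x y u v)) (a , ne)

  delete-adj⁻ : Adj (deleteEdge G u v) x y → Adj G x y × ¬ SameEdge x y u v
  delete-adj⁻ = row⁻ (λ x → x ∈? vertices G)
    (λ x y → Adj? G x y ×-dec ¬? (sameEdge? x y u v))

  delete-nonedge : ¬ Adj G u v → deleteEdge G u v ≡ G
  delete-nonedge ¬uv = graph-ext delete-vertex⁻ delete-vertex⁺ (proj₁ ∘ delete-adj⁻)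
    λ a → delete-adj⁺ a λ
      { (inj₁ (refl , refl)) → ¬uv a
      ; (inj₂ (refl , refl)) → ¬uv (adj-sym G a) }

delete-⋃ : (F : Fin k → Graph n) (u v : Fin n) →
           deleteEdge (⋃ F) u v ≡ ⋃ (λ i → deleteEdge (F i) u v)
delete-⋃ {k} {n} F u v = graph-ext
  (λ p → let i , q = ⋃-vertex⁻ F (delete-vertex⁻ (⋃ F) u v p)
         in ⋃-vertex⁺ D i (delete-vertex⁺ (F i) u v q))
  (λ p → let i , q = ⋃-vertex⁻ D p
         in delete-vertex⁺ (⋃ F) u v (⋃-vertex⁺ F i (delete-vertex⁻ (F i) u v q)))
  (λ a → let b , ne = delete-adj⁻ (⋃ F) u v a
             i , c = ⋃-adj⁻ F b
         in ⋃-adj⁺ D i (delete-adj⁺ (F i) u v c ne))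
  (λ a → let i , b = ⋃-adj⁻ D a
             c , ne = delete-adj⁻ (F i) u v b
         in delete-adj⁺ (⋃ F) u v (⋃-adj⁺ F i c) ne)
  where
  D : Fin k → Graph n
  D i = deleteEdge (F i) u v

-- T ↾ H has all vertices of H, including those outside T.
_↾_ : Graph n → Graph n → Graph n
T ↾ H = mkGraph (λ x → x ∈? vertices H) (λ x y → Adj? T x y ×-dec Adj? H x y)
  (λ (a , b) → adj-sym T a , adj-sym H b)
  (λ (a , _) → adj-irrefl T a)
  (λ (_ , b) → adj-vertex H b)

module _ (T H : Graph n) where

  ↾-vertex⁺ : x ∈ vertices H → x ∈ vertices (T ↾ H)
  ↾-vertex⁺ = ∈⟪⟫⁺ (λ x → x ∈? vertices H)

  ↾-vertex⁻ : x ∈ vertices (T ↾ H) → x ∈ vertices H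
  ↾-vertex⁻ = ∈⟪⟫⁻ (λ x → x ∈? vertices H)

  ↾-adj⁺ : Adj T x y → Adj H x y → Adj (T ↾ H) x y
  ↾-adj⁺ a b = row⁺ (λ x → x ∈? vertices H)
    (λ x y → Adj? T x y ×-dec Adj? H x y) (a , b)

  ↾-adj⁻ : Adj (T ↾ H) x y → Adj T x y × Adj H x y
  ↾-adj⁻ = row⁻ (λ x → x ∈? vertices H) (λ x y → Adj? T x y ×-dec Adj? H x y)

-- Cycles and bridges

-- Acyclicity stated edge by edge. A walk that bypasses an edge survives a retraction onto a part,
-- whereas the distinct vertices of a cycle could be identified.
Bridges : Graph n → Set
Bridges G = ∀ {x y} → Adj G x y → ¬ Star (Adj (deleteEdge G x y)) x y

module _ {V : Set} {E : V → V → Set} where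

  infixr 5 _∷_

  data Path : ℕ → V → V → Set where
    []  : ∀ {x} → Path 0 x x
    _∷_ : ∀ {x y z k} → E x y → Path k y z → Path (suc k) x z

  at : ∀ {x y k} → Path k x y → Fin (suc k) → V
  at {x} p zero    = x
  at (e ∷ p) (suc i) = at p i

  at-last : ∀ {x y k} (p : Path k x y) → at p (fromℕ k) ≡ y
  at-last []      = refl
  at-last (e ∷ p) = at-last p

  at-step : ∀ {x y k} (p : Path k x y) (i : Fin k) → E (at p (inject₁ i)) (at p (suc i))
  at-step (e ∷ p) zero    = e
  at-step (e ∷ p) (suc i) = at-step p i

  Simple : ∀ {x y k} → Path k x y → Set
  Simple p = ∀ {i j} → at p i ≡ at p j → i ≡ j

  suffix : ∀ {x y k} (p : Path k x y) → Simple p → ∀ i →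
           ∃[ l ] Σ (Path l (at p i) y) Simple
  suffix p       simple zero    = _ , p , simple
  suffix (e ∷ p) simple (suc i) = suffix p (suc-injective ∘ simple) i

  ∷-simple : ∀ {x y z k} (e : E x y) (p : Path k y z) →
             ¬ ∃ (λ i → at p i ≡ x) → Simple p → Simple (e ∷ p)
  ∷-simple e p x∉p simple {zero}  {zero}  _  = refl
  ∷-simple e p x∉p simple {zero}  {suc j} eq = contradiction (j , sym eq) x∉p
  ∷-simple e p x∉p simple {suc i} {zero}  eq = contradiction (i , eq) x∉p
  ∷-simple e p x∉p simple {suc i} {suc j} eq = cong suc (simple eq)

-- Loop erasure: if `x` already occurs on the simple path built from the rest of the walk, that path
-- is cut to start at this occurrence.
walk⇒simple-path : {E : Rel (Fin n) 0ℓ} → Star E x y → ∃[ k ] Σ (Path {E = E} k x y) Simple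
walk⇒simple-path ε = 0 , [] , λ { {zero} {zero} _ → refl }
walk⇒simple-path {x = x} (e ◅ w) with walk⇒simple-path w
... | k , p , simple with any? (λ i → at p i ≟ x)
...   | yes (i , refl) = suffix p simple i
...   | no x∉p = suc k , e ∷ p , ∷-simple e p x∉p simple

steps⇒walk : {V : Set} {E : V → V → Set} (f : Fin (suc k) → V) →
             (∀ i → E (f (inject₁ i)) (f (suc i))) → Star E (f zero) (f (fromℕ k))
steps⇒walk {zero}  f step = ε
steps⇒walk {suc k} f step = step zero ◅ steps⇒walk (f ∘ suc) (step ∘ suc)

acyclic⇒bridges : (G : Graph n) → Acyclic G → Bridges G
acyclic⇒bridges G acyclic {x} {y} xy w with walk⇒simple-path w
-- Length 0 would make the edge a loop, and length 1 would be the deleted edge itself. Any longer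
-- path has the three vertices that `Cycle` asks for.
... | 0 , [] , _ = adj-irrefl G xy
... | 1 , e ∷ [] , _ = proj₂ (delete-adj⁻ G x y e) (inj₁ (refl , refl))
... | suc (suc k) , p , simple = acyclic record
  { vertex   = at p
  ; distinct = simple
  ; step     = λ i → proj₁ (delete-adj⁻ G x y (at-step p i))
  ; close    = subst (λ z → Adj G z x) (sym (at-last p)) (adj-sym G xy)
  }

-- The closing edge of a cycle cannot be a bridge, because the other steps join its ends.
bridges⇒acyclic : (G : Graph n) → Bridges G → Acyclic G
bridges⇒acyclic G bridges C = bridges (adj-sym G close) (steps⇒walk vertex kept)
  where
  open Cycle C
  kept : ∀ i → Adj (deleteEdge G (vertex zero) (vertex (fromℕ _))) (vertex (inject₁ i)) (vertex (suc i))
  kept i = delete-adj⁺ G _ _ (step i) λ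
    -- A step could run along the closing edge in this direction only if the cycle had just two
    -- vertices.
    { (inj₁ (p , q)) → closing i (distinct p) (distinct q)
    ; (inj₂ (p , q)) → contradiction (distinct q) λ () }
    where
    closing : ∀ (i : Fin (2 + extra)) → inject₁ i ≡ zero → suc i ≢ fromℕ (2 + extra)
    closing zero _ ()

-- Automorphisms

infixr 6 _·_

_·_ : {H : Graph n} {u v : Fin n} → Autₒᵣ H u v → Fin n → Fin n
σ · x = Autₒᵣ.perm σ ⟨$⟩ʳ x

mkAut : {H : Graph n} {u v : Fin n} (π : Permutation′ n) →
        (∀ {x} → x ∉ vertices H → π ⟨$⟩ʳ x ≡ x) →
        (∀ {x y} → Adj H x y → Adj H (π ⟨$⟩ʳ x) (π ⟨$⟩ʳ y)) →
        (∀ {x y} → Adj H x y → Adj H (π ⟨$⟩ˡ x) (π ⟨$⟩ˡ y)) →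
        π ⟨$⟩ʳ u ≡ u → π ⟨$⟩ʳ v ≡ v → Autₒᵣ H u v
mkAut {H = H} π out to from u v = record
  { perm = π ; fix-outside = out ; fix-u = u ; fix-v = v
  ; preserve-adj = mk⇔ to λ a → subst₂ (Adj H) (inverseˡ π) (inverseˡ π) (from a)
  }

module _ {H : Graph n} {u v : Fin n} (σ : Autₒᵣ H u v) where
  open Autₒᵣ σ

  aut-adj : Adj H x y → Adj H (σ · x) (σ · y)
  aut-adj = Equivalence.to preserve-adj

  aut-injective : σ · x ≡ σ · y → x ≡ y
  aut-injective eq = trans (sym (inverseˡ perm)) (trans (cong (perm ⟨$⟩ˡ_) eq) (inverseˡ perm))

  -- A vertex `σ · x` outside `H` would be fixed by `σ`, and injectivity would then give
  -- `σ · x ≡ x`.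
  aut-vertex : x ∈ vertices H → σ · x ∈ vertices H
  aut-vertex {x} p with (σ · x) ∈? vertices H
  ... | yes q = q
  ... | no ¬q = subst (_∈ vertices H) (sym (aut-injective (fix-outside ¬q))) p

  private
    back : σ · x ≡ y → perm ⟨$⟩ˡ y ≡ x
    back refl = inverseˡ perm

  inverse : Autₒᵣ H u v
  inverse = mkAut (flip perm) (back ∘ fix-outside)
    (λ a → Equivalence.from preserve-adj (subst₂ (Adj H) (sym (inverseʳ perm)) (sym (inverseʳ perm)) a))
    aut-adj (back fix-u) (back fix-v)

-- Pieces of a serial composition

Walk : Graph n → (Fin n → Set) → Fin n → Fin n → Set
Walk G Q = Star λ x y → Adj G x y × Q x × Q y

-- What the automorphism argument needs to know about a series-parallel graph, for one orientation:
-- `v` is reachable from everywhere, and deleting `u` cuts nothing off from `v`.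
record Half (H : Graph n) (u v : Fin n) : Set where
  field
    u∈    : u ∈ vertices H
    v∈    : v ∈ vertices H
    u≢v   : u ≢ v
    reach : ∀ {w} → w ∈ vertices H → Star (Adj H) w v
    avoid : ∀ {w} → w ∈ vertices H → w ≢ u → Walk H (_≢ u) w v

-- R is one side of the cut vertex c, the side containing e.
record CutSide (G : Graph n) (R : Fin n → Set) (c e : Fin n) : Set where
  field
    R?       : Decidable R
    c∈       : R c
    e∈       : R e
    e≢c      : e ≢ c
    boundary : R x → x ≢ c → Adj G x y → R y
    inside   : R x → Walk G R x e
    avoid    : R x → x ≢ c → Walk G (_≢ c) x e

-- Among the `n + 1` iterates of `f` from the zeroth to the `n`-th, two agree at `c`. Cancelling the
-- injective `f` from both exhibits `c` as `f` of an iterate, and all iterates satisfy `P`.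
orbit-returns : (f : Fin n → Fin n) → (∀ {x y} → f x ≡ f y → x ≡ y) →
                (P : Fin n → Set) → (∀ {x} → P x → P (f x)) →
                ∀ {c} → P c → ∃ λ x → P x × f x ≡ c
orbit-returns {n} f inj P closed {c} pc =
  let i , j , i<j , eq = pigeonhole (ℕₚ.n<1+n n) (λ i → fold c f (toℕ i))
      d , r = cancel (toℕ i) (toℕ j) i<j eq
  in fold c f d , stays d , sym r
  where
  cancel : ∀ a b → a ℕ.< b → fold c f a ≡ fold c f b → ∃ λ d → c ≡ f (fold c f d)
  cancel zero    (suc b) _         eq = b , eq
  cancel (suc a) (suc b) (s≤s a<b) eq = cancel a b a<b (inj eq)
  stays : ∀ d → P (fold c f d)
  stays zero    = pc
  stays (suc d) = closed (stays d)

module _ {G : Graph n} {R : Fin n → Set} {c e : Fin n} (S : CutSide G R c e) where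
  open CutSide S

  -- Followed back from `e`, the walk starts in `R` and could leave it only through `c`.
  cut-confines : Walk G (_≢ c) x e → R x
  cut-confines ε = e∈
  cut-confines ((a , _ , y≢c) ◅ w) = boundary (cut-confines w) y≢c (adj-sym G a)

  module _ {u v : Fin n} (σ : Autₒᵣ G u v) (σe≡e : σ · e ≡ e) where

    -- If σ c lies outside R, then σ⁻¹ turns walks inside R into walks avoiding c,
    -- so it maps R injectively into R ∖ {c}, which is impossible as R is finite.
    aut-cut∈side : R (σ · c)
    aut-cut∈side = decidable-stable (R? (σ · c)) λ σc∉ →
      let τ = inverse σ
          τ≢c : ∀ {z} → R z → τ · z ≢ c
          τ≢c = λ { r refl → σc∉ (subst R (sym (inverseʳ (Autₒᵣ.perm σ))) r) }
          τe≡e = trans (cong (τ ·_) (sym σe≡e)) (inverseˡ (Autₒᵣ.perm σ))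
          τR : ∀ {z} → R z → R (τ · z)
          τR = λ r → cut-confines (subst (Walk G (_≢ c) _) τe≡e
                 (Star.gmap (τ ·_) (λ (a , p , q) → aut-adj τ a , τ≢c p , τ≢c q) (inside r)))
          z , Rz , τz≡c = orbit-returns (τ ·_) (aut-injective τ) R τR c∈
      in τ≢c Rz τz≡c

    -- Once `c` is fixed, `σ` carries walks to `e` that avoid `c` to walks of the same kind, and
    -- those are confined to `R`.
    aut-side : σ · c ≡ c → R x → R (σ · x)
    aut-side {x} σc≡c r with x ≟ c
    ... | yes refl = subst R (sym σc≡c) c∈
    ... | no x≢c = cut-confines (subst (Walk G (_≢ c) _) σe≡e
      (Star.gmap (σ ·_) (λ (a , p , q) → aut-adj σ a , σ≢c p , σ≢c q) (avoid r x≢c)))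
      where
      σ≢c : ∀ {z} → z ≢ c → σ · z ≢ c
      σ≢c z≢c eq = z≢c (aut-injective σ (trans eq (sym σc≡c)))

-- A serial composition traversed in one of its two directions: the order is
-- _<_ when end = t and _>_ when end = s.  For i ≺ j ≺ l, meet makes x both
-- near j and near l, which are distinct: non-consecutive parts are disjoint.
record Chain (_≺_ : Fin k → Fin k → Set) (Gs : Fin k → Graph n)
             (near far : Fin k → Fin n) (end : Fin n) : Set₁ where

  _≼_ : Fin k → Fin k → Set
  i ≼ j = i ≡ j ⊎ i ≺ j

  field
    ≺-cmp   : Trichotomous _≡_ _≺_
    ≺-trans : Transitive _≺_
    half    : ∀ i → Half (Gs i) (near i) (far i)
    climb   : ∀ (P : Fin k → Set) → (∀ i → far i ≡ end → P i) →
              (∀ i j → i ≺ j → far i ≡ near j → P j → P i) → ∀ i → P i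
    meet    : ∀ {i j l x} → i ≺ j → j ≼ l → x ∈ vertices (Gs i) → x ∈ vertices (Gs l) →
              x ≡ far i × x ≡ near j

  private
    module H i = Half (half i)

  _≼?_ : ∀ i j → Dec (i ≼ j)
  i ≼? j with ≺-cmp i j
  ... | tri< p _ _ = yes (inj₂ p)
  ... | tri≈ _ p _ = yes (inj₁ p)
  ... | tri> ¬p ¬q _ = no λ { (inj₁ q) → ¬q q ; (inj₂ p) → ¬p p }

  ≺-≼-trans : ∀ {i j l} → i ≺ j → j ≼ l → i ≺ l
  ≺-≼-trans p (inj₁ refl) = p
  ≺-≼-trans p (inj₂ q)    = ≺-trans p q

  Beyond : Fin k → Fin n → Set
  Beyond i x = ∃ λ l → i ≼ l × x ∈ vertices (Gs l)

  -- If `near i` occurred in a later part, `meet` would identify it with `far i`.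
  near∉beyond : ∀ {i j} → i ≺ j → Beyond j x → x ≢ near i
  near∉beyond {i = i} i≺j (l , j≼l , x∈) refl =
    H.u≢v i (proj₁ (meet i≺j j≼l (H.u∈ i) x∈))

  private
    -- The invariant for the induction `climb` from the end of the chain. Its walks start in part
    -- `i` only; `cut-side` treats starting points in later parts.
    record EndReachable (i : Fin k) : Set where
      field
        end∈   : Beyond i end
        end≢   : end ≢ near i
        inside : ∀ {x} → x ∈ vertices (Gs i) → Walk (⋃ Gs) (Beyond i) x end
        avoid  : ∀ {x} → x ∈ vertices (Gs i) → x ≢ near i → Walk (⋃ Gs) (_≢ near i) x end

    into : ∀ {x y} i → Star (Adj (Gs i)) x y → Walk (⋃ Gs) (Beyond i) x y
    into i = Star.map λ a → ⋃-adj⁺ Gs i a ,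
      (i , inj₁ refl , adj-vertex (Gs i) a) , (i , inj₁ refl , adj-vertexʳ (Gs i) a)

    lift : ∀ {x y} i {Q : Fin n → Set} → Walk (Gs i) Q x y → Walk (⋃ Gs) Q x y
    lift i = Star.map λ (a , q) → ⋃-adj⁺ Gs i a , q

    weaken : ∀ {Q Q′ : Fin n → Set} {x y} → (∀ {z} → Q z → Q′ z) →
             Walk (⋃ Gs) Q x y → Walk (⋃ Gs) Q′ x y
    weaken f = Star.map λ (a , p , q) → a , f p , f q

    end-reachable : ∀ i → EndReachable i
    end-reachable = climb EndReachable last step
      where
      last : ∀ i → far i ≡ end → EndReachable i
      last i refl = record
        { end∈   = i , inj₁ refl , H.v∈ i
        ; end≢   = ≢-sym (H.u≢v i)
        ; inside = λ p → into i (H.reach i p)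
        ; avoid  = λ p x≢ → lift i (H.avoid i p x≢)
        }
      -- Walk inside part `i` to `far i`, which is `near j`, and continue as from part `j`. The
      -- continuation stays beyond `j`, so it also avoids `near i`.
      step : ∀ i j → i ≺ j → far i ≡ near j → EndReachable j → EndReachable i
      step i j i≺j eq J = record
        { end∈   = shrink (J.end∈)
        ; end≢   = near∉beyond i≺j J.end∈
        ; inside = λ p → into i (H.reach i p) ◅◅ weaken shrink onward
        ; avoid  = λ p x≢ → lift i (H.avoid i p x≢) ◅◅ weaken (near∉beyond i≺j) onward
        }
        where
        module J = EndReachable J
        shrink : ∀ {x} → Beyond j x → Beyond i x
        shrink (l , j≼l , x∈) = l , inj₂ (≺-≼-trans i≺j j≼l) , x∈
        onward : Walk (⋃ Gs) (Beyond j) (far i) end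
        onward = subst (λ z → Walk (⋃ Gs) (Beyond j) z end) (sym eq) (J.inside (H.u∈ j))

  cut-side : ∀ i → CutSide (⋃ Gs) (Beyond i) (near i) end
  cut-side i = record
    { R?       = λ x → any? λ l → (i ≼? l) ×-dec (x ∈? vertices (Gs l))
    ; c∈       = i , inj₁ refl , H.u∈ i
    ; e∈       = E.end∈ i
    ; e≢c      = E.end≢ i
    ; boundary = boundary
    ; inside   = λ { (l , inj₁ refl , x∈) → E.inside i x∈
                   ; (l , inj₂ i≺l , x∈) →
                       weaken (λ (h , l≼h , z∈) → h , inj₂ (≺-≼-trans i≺l l≼h) , z∈) (E.inside l x∈) }
    ; avoid    = λ { (l , inj₁ refl , x∈) x≢ → E.avoid i x∈ x≢
                   ; (l , inj₂ i≺l , x∈) x≢ → weaken (near∉beyond i≺l) (E.inside l x∈) }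
    }
    where
    module E i = EndReachable (end-reachable i)
    boundary : ∀ {x y} → Beyond i x → x ≢ near i → Adj (⋃ Gs) x y → Beyond i y
    boundary (l , i≼l , x∈) x≢ a with ⋃-adj⁻ Gs a
    ... | h , b with ≺-cmp h i
    -- An edge leading into an earlier part `h` puts `x` both in part `h` and in a part beyond `i`,
    -- which forces `x ≡ near i`.
    ...   | tri< h≺i _ _ = contradiction (proj₂ (meet h≺i i≼l (adj-vertex (Gs h) b) x∈)) x≢
    ...   | tri≈ _ refl _ = i , inj₁ refl , adj-vertexʳ (Gs i) b
    ...   | tri> _ _ i≺h = h , inj₂ i≺h , adj-vertexʳ (Gs h) b

  -- For the extreme part the cut side is the whole composition. This passes `Half` from the parts
  -- to their serial composition.
  chain-half : ∀ i → (∀ l → i ≼ l) → Half (⋃ Gs) (near i) end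
  chain-half i least = record
    { u∈    = ⋃-vertex⁺ Gs i (H.u∈ i)
    ; v∈    = let l , _ , p = e∈ in ⋃-vertex⁺ Gs l p
    ; u≢v   = ≢-sym e≢c
    ; reach = λ p → Star.map proj₁ (inside (beyond p))
    ; avoid = λ p → avoid (beyond p)
    }
    where
    open CutSide (cut-side i)
    beyond : ∀ {x} → x ∈ vertices (⋃ Gs) → Beyond i x
    beyond p = let l , q = ⋃-vertex⁻ Gs p in l , least l , q

  -- Every vertex walks to `far` of its part, which is `near` of the next part, and so on to `end`.
  chain-connected : (T : Fin k → Graph n) → (∀ i → vertices (T i) ≡ vertices (Gs i)) →
                    (∀ i → Connected (T i)) → Connected (⋃ T)
  chain-connected T same conn x∈ y∈ = toEnd x∈ ◅◅ Star.reverse (adj-sym (⋃ T)) (toEnd y∈)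
    where
    toFar : ∀ i {x} → x ∈ vertices (T i) → Star (Adj (⋃ T)) x (far i)
    toFar i p = Star.map (⋃-adj⁺ T i) (conn i p (subst (far i ∈_) (sym (same i)) (H.v∈ i)))
    part : ∀ i {x} → x ∈ vertices (T i) → Star (Adj (⋃ T)) x end
    part = climb _ (λ { i refl → toFar i })
      λ i j _ eq J p → toFar i p ◅◅
        J (subst₂ _∈_ (sym eq) (sym (same j)) (H.u∈ j))
    toEnd : ∀ {x} → x ∈ vertices (⋃ T) → Star (Adj (⋃ T)) x end
    toEnd p = let i , q = ⋃-vertex⁻ T p in part i q

-- Spanning subgraphs

Spanning : Graph n → Graph n → Set
Spanning A H = IsSubgraph A H × vertices A ≡ vertices H

st-spanning : {H A : Graph n} → ST H A → Spanning A H
st-spanning T = ST.subgraph T , ST.spanning T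

nt-spanning : {H A : Graph n} → NT H A → Spanning A H
nt-spanning (T , tree , u , v , _ , refl) = record
  { vertices-⊆ = vertices-⊆ ∘ delete-vertex⁻ T u v
  ; adj-⊆      = adj-⊆ ∘ proj₁ ∘ delete-adj⁻ T u v
  } , trans (⊆-antisym (delete-vertex⁻ T u v) (delete-vertex⁺ T u v)) (ST.spanning tree)
  where open IsSubgraph (ST.subgraph tree)

-- The deleted edge was a bridge of the tree, so its ends are now separated.
nt-disconnected : {H A : Graph n} → NT H A → ¬ Connected A
nt-disconnected (T , tree , u , v , uv , refl) conn =
  acyclic⇒bridges T (ST.acyclic tree) uv
    (conn (delete-vertex⁺ T u v (adj-vertex T uv)) (delete-vertex⁺ T u v (adj-vertexʳ T uv)))

⋃-spanning : {Gs F : Fin k → Graph n} → (∀ i → Spanning (F i) (Gs i)) → Spanning (⋃ F) (⋃ Gs)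
⋃-spanning {Gs = Gs} {F} sp = record
  { vertices-⊆ = λ p → let i , q = ⋃-vertex⁻ F p
                       in ⋃-vertex⁺ Gs i (subst (_ ∈_) (proj₂ (sp i)) q)
  ; adj-⊆      = λ a → let i , b = ⋃-adj⁻ F a
                       in ⋃-adj⁺ Gs i (IsSubgraph.adj-⊆ (proj₁ (sp i)) b)
  } , ⊆-antisym
  (λ p → let i , q = ⋃-vertex⁻ F p in ⋃-vertex⁺ Gs i (subst (_ ∈_) (proj₂ (sp i)) q))
  (λ p → let i , q = ⋃-vertex⁻ Gs p in ⋃-vertex⁺ F i (subst (_ ∈_) (sym (proj₂ (sp i))) q))

image-spanning : {H A : Graph n} {u v : Fin n} (σ : Autₒᵣ H u v) →
                 Spanning A H → Spanning (image (Autₒᵣ.perm σ) A) H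
image-spanning {H = H} {A} σ (sub , spans) = record
  { vertices-⊆ = ⊆ ; adj-⊆ = λ a → subst₂ (Adj H) (inverseʳ perm) (inverseʳ perm)
      (aut-adj σ (IsSubgraph.adj-⊆ sub (image-adj⁻ perm A a))) } ,
  ⊆-antisym ⊆ λ {x} p →
    image-vertex⁺ perm A (subst (perm ⟨$⟩ˡ x ∈_) (sym spans) (aut-vertex (inverse σ) p))
  where
  open Autₒᵣ σ
  ⊆ : ∀ {x} → x ∈ vertices (image perm A) → x ∈ vertices H
  ⊆ p = subst (_∈ vertices H) (inverseʳ perm)
    (aut-vertex σ (IsSubgraph.vertices-⊆ sub (image-vertex⁻ perm A p)))

-- Acting on one part only

on : Subset n → (Fin n → Fin n) → Fin n → Fin n
on S f x with x ∈? S
... | yes _ = f x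
... | no _  = x

module _ {S : Subset n} where

  on-∈ : ∀ f → x ∈ S → on S f x ≡ f x
  on-∈ {x} f p with x ∈? S
  ... | yes _ = refl
  ... | no ¬p = contradiction p ¬p

  on-∉ : ∀ f → x ∉ S → on S f x ≡ x
  on-∉ {x} f ¬p with x ∈? S
  ... | yes p = contradiction p ¬p
  ... | no _  = refl

  on-inverse : ∀ {f g} → (∀ {x} → x ∈ S → g x ∈ S) → (∀ {x} → f (g x) ≡ x) →
               ∀ x → on S f (on S g x) ≡ x
  on-inverse {f} {g} closed inv x with x ∈? S
  ... | yes p = trans (on-∈ f (closed p)) inv
  ... | no ¬p = on-∉ f ¬p

restrict-aut : {G H : Graph n} {a b u v : Fin n} (σ : Autₒᵣ G a b) → IsSubgraph H G →
               (∀ {x y} → x ∈ vertices H → y ∈ vertices H → Adj G x y → Adj H x y) →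
               (∀ {x} → x ∈ vertices H → σ · x ∈ vertices H) →
               (∀ {x} → x ∈ vertices H → inverse σ · x ∈ vertices H) →
               u ∈ vertices H → v ∈ vertices H → σ · u ≡ u → σ · v ≡ v →
               Σ (Autₒᵣ H u v) λ τ → ∀ {x} → x ∈ vertices H → σ · x ≡ τ · x
restrict-aut {G = G} {H} σ sub induced closed closed⁻ u∈ v∈ σu σv = mkAut
  (permutation (on S (σ ·_)) (on S (inverse σ ·_))
    (on-inverse closed⁻ (inverseʳ perm)) (on-inverse closed (inverseˡ perm)))
  (on-∉ (σ ·_)) (adj σ closed) (adj (inverse σ) closed⁻)
  (trans (on-∈ (σ ·_) u∈) σu) (trans (on-∈ (σ ·_) v∈) σv) ,
  λ p → sym (on-∈ (σ ·_) p)
  where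
  open Autₒᵣ σ using (perm)
  S = vertices H
  adj : (τ : Autₒᵣ G _ _) → (∀ {x} → x ∈ S → τ · x ∈ S) →
        ∀ {x y} → Adj H x y → Adj H (on S (τ ·_) x) (on S (τ ·_) y)
  adj τ cl a = let x∈ = adj-vertex H a ; y∈ = adj-vertexʳ H a in
    -- The image edge is known only in `G`; it lies in `H` because both its ends do and `H` is
    -- induced.
    subst₂ (Adj H) (sym (on-∈ (τ ·_) x∈)) (sym (on-∈ (τ ·_) y∈))
      (induced (cl x∈) (cl y∈) (aut-adj τ (IsSubgraph.adj-⊆ sub a)))

image-⋃ : {Gs F : Fin k → Graph n} {ss ts : Fin k → Fin n} (π : Permutation′ n)
          (σs : ∀ i → Autₒᵣ (Gs i) (ss i) (ts i)) →
          (∀ i {x} → x ∈ vertices (Gs i) → π ⟨$⟩ʳ x ≡ σs i · x) →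
          (∀ i → IsSubgraph (F i) (Gs i)) →
          image π (⋃ F) ≡ ⋃ (λ i → image (Autₒᵣ.perm (σs i)) (F i))
image-⋃ {Gs = Gs} {F} π σs agree sub = graph-ext
  (λ p → let i , q = ⋃-vertex⁻ F (image-vertex⁻ π (⋃ F) p) in
    ⋃-vertex⁺ I i (image-vertex⁺ (σ i) (F i) (subst (_∈ vertices (F i)) (away i (⊆ i q)) q)))
  (λ p → let i , q = ⋃-vertex⁻ I p ; q′ = image-vertex⁻ (σ i) (F i) q in
    image-vertex⁺ π (⋃ F) (⋃-vertex⁺ F i (subst (_∈ vertices (F i)) (sym (back i (⊆ i q′))) q′)))
  (λ a → let i , b = ⋃-adj⁻ F (image-adj⁻ π (⋃ F) a) in
    ⋃-adj⁺ I i (image-adj⁺ (σ i) (F i) (subst₂ (Adj (F i))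
      (away i (⊆ i (adj-vertex (F i) b))) (away i (⊆ i (adj-vertexʳ (F i) b))) b)))
  (λ a → let i , c = ⋃-adj⁻ I a ; b = image-adj⁻ (σ i) (F i) c in
    image-adj⁺ π (⋃ F) (⋃-adj⁺ F i (subst₂ (Adj (F i))
      (sym (back i (⊆ i (adj-vertex (F i) b)))) (sym (back i (⊆ i (adj-vertexʳ (F i) b)))) b)))
  where
  σ = λ i → Autₒᵣ.perm (σs i)
  I = λ i → image (σ i) (F i)
  ⊆ : ∀ i {x} → x ∈ vertices (F i) → x ∈ vertices (Gs i)
  ⊆ i = IsSubgraph.vertices-⊆ (sub i)
  -- `image` is defined through preimages, so agreement of the permutations on a part is turned into
  -- agreement of their inverses, as soon as one of the two preimages is known to lie in the part.
  back : ∀ i {x} → σ i ⟨$⟩ˡ x ∈ vertices (Gs i) → π ⟨$⟩ˡ x ≡ σ i ⟨$⟩ˡ x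
  back i {x} p = trans
    (cong (π ⟨$⟩ˡ_) (sym (trans (agree i p) (inverseʳ (σ i))))) (inverseˡ π)
  away : ∀ i {x} → π ⟨$⟩ˡ x ∈ vertices (Gs i) → π ⟨$⟩ˡ x ≡ σ i ⟨$⟩ˡ x
  away i p = trans (sym (inverseˡ (σ i)))
    (cong (σ i ⟨$⟩ˡ_) (trans (sym (agree i p)) (inverseʳ π)))

-- Retractions onto the parts

-- r i maps a walk in the union to a walk in the part i, since it contracts
-- every other part to a single vertex.
record Gluing (Gs : Fin k → Graph n) : Set where
  field
    r        : Fin k → Fin n → Fin n
    fixes    : ∀ i → x ∈ vertices (Gs i) → r i x ≡ x
    collapse : ∀ {i l} → i ≢ l → x ∈ vertices (Gs l) → y ∈ vertices (Gs l) → r i x ≡ r i y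

  -- `r i` fixes both ends of the edge, as they lie in part `i`, but would identify them if the edge
  -- belonged to another part.
  edge-part : ∀ {i l} → x ∈ vertices (Gs i) → y ∈ vertices (Gs i) → Adj (Gs l) x y → i ≡ l
  edge-part {i = i} {l} x∈ y∈ a with i ≟ l
  ... | yes eq = eq
  ... | no i≢l = contradiction
    (trans (sym (fixes i x∈))
      (trans (collapse i≢l (adj-vertex (Gs l) a) (adj-vertexʳ (Gs l) a)) (fixes i y∈)))
    (adj-≢ (Gs l) a)

  -- The relations are left general to serve two purposes: connectedness of a restricted tree, and
  -- walks bypassing a deleted edge.
  retract-walk : {E E′ : Rel (Fin n) 0ℓ} (i : Fin k) →
                 (∀ {a b} → E a b → ∃ λ l → Adj (Gs l) a b) →
                 (∀ {a b} → E a b → Adj (Gs i) a b → E′ a b) →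
                 x ∈ vertices (Gs i) → y ∈ vertices (Gs i) → Star E x y → Star E′ x y
  retract-walk {E = E} {E′} i part keep x∈ y∈ w =
    subst₂ (Star E′) (fixes i x∈) (fixes i y∈) (Star.kleisliStar (r i) step w)
    where
    step : ∀ {a b} → E a b → Star E′ (r i a) (r i b)
    step {a} e with part e
    ... | l , ab with i ≟ l
    ...   | yes refl = subst₂ E′ (sym (fixes i (adj-vertex (Gs i) ab)))
                                 (sym (fixes i (adj-vertexʳ (Gs i) ab))) (keep e ab) ◅ ε
    ...   | no i≢l = subst (Star E′ (r i a))
                       (collapse i≢l (adj-vertex (Gs l) ab) (adj-vertexʳ (Gs l) ab)) ε

  -- A walk bypassing an edge of part `i` retracts to a walk bypassing it inside that part.
  ⋃-bridges : (T : Fin k → Graph n) → (∀ i → IsSubgraph (T i) (Gs i)) →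
              (∀ i → Bridges (T i)) → Bridges (⋃ T)
  ⋃-bridges T sub bridges {x} {y} a w with ⋃-adj⁻ T a
  ... | i , b = bridges i b (retract-walk i part keep (x∈ b) (x∈ (adj-sym (T i) b)) w)
    where
    module S i = IsSubgraph (sub i)
    x∈ : ∀ {x y} → Adj (T i) x y → x ∈ vertices (Gs i)
    x∈ b = S.vertices-⊆ i (adj-vertex (T i) b)
    part : ∀ {a b} → Adj (deleteEdge (⋃ T) x y) a b → ∃ λ l → Adj (Gs l) a b
    part e = let l , c = ⋃-adj⁻ T (proj₁ (delete-adj⁻ (⋃ T) x y e)) in l , S.adj-⊆ l c
    keep : ∀ {a b} → Adj (deleteEdge (⋃ T) x y) a b → Adj (Gs i) a b → Adj (deleteEdge (T i) x y) a b
    keep e ab with delete-adj⁻ (⋃ T) x y e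
    ... | c , ne with ⋃-adj⁻ T c
    ...   | l , d with edge-part (adj-vertex (Gs i) ab) (adj-vertexʳ (Gs i) ab) (S.adj-⊆ l d)
    ...     | refl = delete-adj⁺ (T i) x y d ne

  ⋃-adj-part : ∀ i → x ∈ vertices (Gs i) → y ∈ vertices (Gs i) → Adj (⋃ Gs) x y → Adj (Gs i) x y
  ⋃-adj-part i x∈ y∈ a with ⋃-adj⁻ Gs a
  ... | l , b with edge-part x∈ y∈ b
  ...   | refl = b

  -- An edge lies in only one part, so the union determines which member each edge came from; the
  -- vertex sets are prescribed by spanning.
  parts-unique : (F F′ : Fin k → Graph n) → (∀ i → Spanning (F i) (Gs i)) →
                 (∀ i → Spanning (F′ i) (Gs i)) → ⋃ F ≡ ⋃ F′ → ∀ i → F i ≡ F′ i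
  parts-unique F F′ sp sp′ eq i = graph-ext
    (subst (_ ∈_) (trans (proj₂ (sp i)) (sym (proj₂ (sp′ i)))))
    (subst (_ ∈_) (trans (proj₂ (sp′ i)) (sym (proj₂ (sp i)))))
    (within sp sp′ eq) (within sp′ sp (sym eq))
    where
    within : ∀ {F F′} → (∀ i → Spanning (F i) (Gs i)) → (∀ i → Spanning (F′ i) (Gs i)) →
             ⋃ F ≡ ⋃ F′ → ∀ {x y} → Adj (F i) x y → Adj (F′ i) x y
    within {F} {F′} sp sp′ eq {x} {y} a
      with ⋃-adj⁻ F′ (subst (λ H → Adj H x y) eq (⋃-adj⁺ F i a))
    ... | l , b with IsSubgraph.adj-⊆ (proj₁ (sp i)) a
    ...   | c with edge-part (adj-vertex (Gs i) c) (adj-vertexʳ (Gs i) c)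
                             (IsSubgraph.adj-⊆ (proj₁ (sp′ l)) b)
    ...     | refl = b

  -- Connecting walks of `T` retract onto the part, and a cycle of the restriction is already a
  -- cycle of `T`.
  restrict-tree : ∀ {T} → ST (⋃ Gs) T → ∀ i → ST (Gs i) (T ↾ Gs i)
  restrict-tree {T} tree i = record
    { subgraph  = record { vertices-⊆ = ↾-vertex⁻ T (Gs i) ; adj-⊆ = proj₂ ∘ ↾-adj⁻ T (Gs i) }
    ; spanning  = ⊆-antisym (↾-vertex⁻ T (Gs i)) (↾-vertex⁺ T (Gs i))
    ; connected = λ p q →
        let x∈ = ↾-vertex⁻ T (Gs i) p ; y∈ = ↾-vertex⁻ T (Gs i) q in
        retract-walk i (⋃-adj⁻ Gs ∘ adj-⊆) (↾-adj⁺ T (Gs i)) x∈ y∈ (connected (inT x∈) (inT y∈))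
    ; acyclic   = λ C → let open Cycle C in acyclic record
        { vertex = vertex ; distinct = distinct
        ; step = proj₁ ∘ ↾-adj⁻ T (Gs i) ∘ step ; close = proj₁ (↾-adj⁻ T (Gs i) close) }
    }
    where
    open ST tree
    open IsSubgraph subgraph
    inT : ∀ {x} → x ∈ vertices (Gs i) → x ∈ vertices T
    inT p = subst (_ ∈_) (sym spanning) (⋃-vertex⁺ Gs i p)

⋃-↾ : (Gs : Fin k → Graph n) (T : Graph n) → Spanning T (⋃ Gs) → T ≡ ⋃ (λ i → T ↾ Gs i)
⋃-↾ Gs T (sub , spans) = graph-ext
  (λ p → let i , q = ⋃-vertex⁻ Gs (vertices-⊆ p) in ⋃-vertex⁺ P i (↾-vertex⁺ T (Gs i) q))
  (λ p → let i , q = ⋃-vertex⁻ P p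
         in subst (_ ∈_) (sym spans) (⋃-vertex⁺ Gs i (↾-vertex⁻ T (Gs i) q)))
  (λ a → let i , b = ⋃-adj⁻ Gs (adj-⊆ a) in ⋃-adj⁺ P i (↾-adj⁺ T (Gs i) a b))
  (λ a → let i , b = ⋃-adj⁻ P a in proj₁ (↾-adj⁻ T (Gs i) b))
  where
  open IsSubgraph sub
  P = λ i → T ↾ Gs i

-- Serial compositions

module Serial {G : Graph n} {s t : Fin n} {Gs : Fin (2 + m) → Graph n} {ss ts : Fin (2 + m) → Fin n}
              (C : IsSerialComposition G s t Gs ss ts)
              (forward  : ∀ i → Half (Gs i) (ss i) (ts i))
              (backward : ∀ i → Half (Gs i) (ts i) (ss i)) where
  open IsSerialComposition C

  private
    inject₁<suc : ∀ {n} (i : Fin n) → inject₁ i < suc i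
    inject₁<suc i = s≤s (ℕₚ.≤-reflexive (toℕ-inject₁ i))

  -- Distant parts are disjoint, so a common vertex forces `l` to be at most `i + 1`. With
  -- `i < j ≤ l` this leaves `j = l = i + 1`, and `x` is the gluing vertex of two consecutive parts.
  meeting : ∀ {i j l x} → i < j → toℕ j ℕ.≤ toℕ l → x ∈ vertices (Gs i) → x ∈ vertices (Gs l) →
            x ≡ ts i × x ≡ ss j × j ≡ l
  meeting {l = zero} i<j j≤0 = contradiction (ℕₚ.<-≤-trans i<j j≤0) λ ()
  meeting {i} {j} {l@(suc _)} {x} i<j j≤l x∈i x∈l with ∣ toℕ i - toℕ l ∣ ℕ.≤? 1
  ... | no far = contradiction (subst (x ∈_) (distant i l (ℕₚ.≰⇒> far)) (x∈p∩q⁺ (x∈i , x∈l))) ∉⊥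
  meeting {i} {j} {suc l} {x} i<j j≤l x∈i x∈l | yes close = x≡ts , trans x≡ss (cong ss (sym j≡l)) , j≡l
    where
    l≤1+i : suc (toℕ l) ℕ.≤ suc (toℕ i)
    l≤1+i = ℕₚ.≤-trans (ℕₚ.m≤n+∣n-m∣ (suc (toℕ l)) (toℕ i))
      (ℕₚ.≤-trans (ℕₚ.+-monoʳ-≤ (toℕ i) close) (ℕₚ.≤-reflexive (ℕₚ.+-comm (toℕ i) 1)))
    j≡l : j ≡ suc l
    j≡l = toℕ-injective (ℕₚ.≤-antisym j≤l (ℕₚ.≤-trans l≤1+i i<j))
    i≡l : i ≡ inject₁ l
    i≡l = toℕ-injective (trans (ℕₚ.≤-antisym (ℕ.s≤s⁻¹ (ℕₚ.<-≤-trans i<j j≤l)) (ℕ.s≤s⁻¹ l≤1+i))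
                               (sym (toℕ-inject₁ l)))
    x≡ss : x ≡ ss (suc l)
    x≡ss = x∈⁅y⁆⇒x≡y _ (subst (x ∈_) (consecutive l)
      (x∈p∩q⁺ (subst (λ i → x ∈ vertices (Gs i)) i≡l x∈i , x∈l)))
    x≡ts : x ≡ ts i
    x≡ts = trans x≡ss (trans (sym (glue l)) (cong ts (sym i≡l)))

  up : Chain _<_ Gs ss ts t
  up = record
    { ≺-cmp = <-cmp ; ≺-trans = <-trans ; half = forward
    ; climb = λ P top step → >-weakInduction P (top _ target)
        λ i → step (inject₁ i) (suc i) (inject₁<suc i) (glue i)
    ; meet = λ { i<j (inj₁ refl) p q → let a , b , _ = meeting i<j ℕₚ.≤-refl p q in a , b
               ; i<j (inj₂ j<l) p q → let a , b , _ = meeting i<j (ℕₚ.<⇒≤ j<l) p q in a , b }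
    }

  down : Chain _>_ Gs ts ss s
  down = record
    { ≺-cmp = λ i j → case-> (<-cmp i j) ; ≺-trans = λ p q → <-trans q p ; half = backward
    ; climb = λ P top step → <-weakInduction P (top _ source)
        λ i → step (suc i) (inject₁ i) (inject₁<suc i) (sym (glue i))
    ; meet = meet
    }
    where
    case-> : ∀ {i j : Fin (2 + m)} → Tri (i < j) (i ≡ j) (i > j) → Tri (i > j) (i ≡ j) (i < j)
    case-> (tri< a b c) = tri> c b a
    case-> (tri≈ a b c) = tri≈ c b a
    case-> (tri> a b c) = tri< c b a
    meet : ∀ {i j l x} → i > j → j ≡ l ⊎ j > l → x ∈ vertices (Gs i) → x ∈ vertices (Gs l) →
           x ≡ ss i × x ≡ ts j
    meet i>j (inj₁ refl) p q = let a , b , _ = meeting i>j ℕₚ.≤-refl q p in b , a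
    -- Here the indices `l < j < i` are distinct, while `meeting` would make `j` equal to `i`.
    meet i>j (inj₂ j>l) p q with meeting j>l (ℕₚ.<⇒≤ i>j) q p
    ... | _ , _ , refl = contradiction i>j (ℕₚ.<-irrefl refl)

  private
    module U = Chain up
    module D = Chain down

  gluing : Gluing Gs
  gluing = record { r = r ; fixes = λ i → fixes i ; collapse = collapse }
    where
    -- Earlier parts are contracted to `ss i` and later ones to `ts i`. Vertices of no part also
    -- receive `ts i`, as a default.
    r : Fin (2 + m) → Fin n → Fin n
    r i x with x ∈? vertices (Gs i) | any? (λ l → (l <? i) ×-dec (x ∈? vertices (Gs l)))
    ... | yes _ | _     = x
    ... | no _  | yes _ = ss i
    ... | no _  | no _  = ts i

    fixes : ∀ i {x} → x ∈ vertices (Gs i) → r i x ≡ x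
    fixes i {x} p with x ∈? vertices (Gs i) | any? (λ l → (l <? i) ×-dec (x ∈? vertices (Gs l)))
    ... | yes _ | _ = refl
    ... | no ¬p | _ = contradiction p ¬p

    before : ∀ {i l x} → l < i → x ∈ vertices (Gs l) → r i x ≡ ss i
    before {i} {l} {x} l<i q
      with x ∈? vertices (Gs i) | any? (λ l → (l <? i) ×-dec (x ∈? vertices (Gs l)))
    ... | yes p | _     = proj₂ (U.meet l<i (inj₁ refl) q p)
    ... | no _  | yes _ = refl
    ... | no _  | no ¬q = contradiction (l , l<i , q) ¬q

    after : ∀ {i l x} → i < l → x ∈ vertices (Gs l) → r i x ≡ ts i
    after {i} {l} {x} i<l q
      with x ∈? vertices (Gs i) | any? (λ l → (l <? i) ×-dec (x ∈? vertices (Gs l)))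
    ... | yes p | _                 = proj₁ (U.meet i<l (inj₁ refl) p q)
    -- A vertex both in an earlier part `h` and in a later part `l` would have to be `ss i`, which
    -- lies in part `i`.
    ... | no ¬p | yes (h , h<i , p) = contradiction
      (subst (_∈ vertices (Gs i)) (sym (proj₂ (U.meet h<i (inj₂ i<l) p q))) (Half.u∈ (forward i))) ¬p
    ... | no _  | no _              = refl

    collapse : ∀ {x y i l} → i ≢ l → x ∈ vertices (Gs l) → y ∈ vertices (Gs l) → r i x ≡ r i y
    collapse {i = i} {l} i≢l p q with <-cmp i l
    ... | tri< i<l _ _ = trans (after i<l p) (sym (after i<l q))
    ... | tri≈ _ i≡l _ = contradiction i≡l i≢l
    ... | tri> _ _ l<i = trans (before l<i p) (sym (before l<i q))

  open Gluing gluing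

  part-subgraph : ∀ i → IsSubgraph (Gs i) (⋃ Gs)
  part-subgraph i = record { vertices-⊆ = ⋃-vertex⁺ Gs i ; adj-⊆ = ⋃-adj⁺ Gs i }

  ⋃-tree : {T : Fin (2 + m) → Graph n} → (∀ i → ST (Gs i) (T i)) → ST (⋃ Gs) (⋃ T)
  ⋃-tree {T} trees = record
    { subgraph  = proj₁ sp
    ; spanning  = proj₂ sp
    ; connected = U.chain-connected T (ST.spanning ∘ trees) (λ i → ST.connected (trees i))
    ; acyclic   = bridges⇒acyclic (⋃ T) (⋃-bridges T (ST.subgraph ∘ trees)
                    λ i → acyclic⇒bridges (T i) (ST.acyclic (trees i)))
    }
    where sp = ⋃-spanning (st-spanning ∘ trees)

  -- Automorphisms of a serial composition

  module _ (σ : Autₒᵣ (⋃ Gs) s t) where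
    open Autₒᵣ σ using (fix-u; fix-v)

    aut-source : ∀ i → σ · ss i ≡ ss i
    aut-source zero = trans (cong (σ ·_) source) (trans fix-u (sym source))
    aut-source (suc i) =
      -- The gluing vertex is the cut vertex of both chains: `ss (suc i)` going up, `ts (inject₁ i)`
      -- going down. Its image lies on both sides, and these share no other vertex.
      let l , i<l , p = aut-cut∈side (U.cut-side (suc i)) σ fix-v
          h , h≤i , q = aut-cut∈side (D.cut-side (inject₁ i)) σ fix-u
      in proj₂ (U.meet (h<1+i h≤i) i<l (subst (λ c → σ · c ∈ vertices (Gs h)) (glue i) q) p)
      where
      h<1+i : ∀ {h} → inject₁ i ≡ h ⊎ inject₁ i > h → h < suc i
      h<1+i (inj₁ refl) = inject₁<suc i
      h<1+i (inj₂ h<i)  = <-trans h<i (inject₁<suc i)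

    aut-target : ∀ i → σ · ts i ≡ ts i
    aut-target = U.climb _ (λ { i refl → fix-v })
      λ i j _ eq _ → trans (cong (σ ·_) eq) (trans (aut-source j) (sym eq))

    -- Both sides are preserved, so `σ · x` lies in a part from `i` upwards and in a part from `i`
    -- downwards. If neither is part `i` itself, then `σ · x` is `ss i`.
    aut-part : ∀ i {x} → x ∈ vertices (Gs i) → σ · x ∈ vertices (Gs i)
    aut-part i {x} p
      with aut-side (U.cut-side i) σ fix-v (aut-source i) (i , inj₁ refl , p)
         | aut-side (D.cut-side i) σ fix-u (aut-target i) (i , inj₁ refl , p)
    ... | _ , inj₁ refl , q | _ = q
    ... | _ , inj₂ _ , _ | _ , inj₁ refl , q = q
    ... | _ , inj₂ i<l , q | _ , inj₂ h<i , q′ =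
      subst (_∈ vertices (Gs i)) (sym (proj₂ (U.meet h<i (inj₂ i<l) q′ q))) (Half.u∈ (forward i))

  restrict : (σ : Autₒᵣ (⋃ Gs) s t) → ∀ i →
             Σ (Autₒᵣ (Gs i) (ss i) (ts i)) λ τ → ∀ {x} → x ∈ vertices (Gs i) → σ · x ≡ τ · x
  restrict σ i = restrict-aut σ (part-subgraph i) (⋃-adj-part i) (aut-part σ i)
    (aut-part (inverse σ) i) (Half.u∈ (forward i)) (Half.v∈ (forward i))
    (aut-source σ i) (aut-target σ i)

  PartAuts : Set
  PartAuts = ∀ i → Autₒᵣ (Gs i) (ss i) (ts i)

  -- The part that `any?` finds does not matter: a vertex of two parts is a terminal of both and is
  -- fixed by both automorphisms.
  glued : PartAuts → Fin n → Fin n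
  glued σs x with any? (λ i → x ∈? vertices (Gs i))
  ... | yes (i , _) = σs i · x
  ... | no _        = x

  terminal-fixed : (σs : PartAuts) → ∀ {i j x} → i ≢ j → x ∈ vertices (Gs i) → x ∈ vertices (Gs j) →
                   σs i · x ≡ x
  terminal-fixed σs {i} {j} i≢j p q with <-cmp i j
  ... | tri< i<j _ _ with refl ← proj₁ (U.meet i<j (inj₁ refl) p q) = Autₒᵣ.fix-v (σs i)
  ... | tri≈ _ i≡j _ = contradiction i≡j i≢j
  ... | tri> _ _ j<i with refl ← proj₂ (U.meet j<i (inj₁ refl) q p) = Autₒᵣ.fix-u (σs i)

  glued-part : (σs : PartAuts) → ∀ i {x} → x ∈ vertices (Gs i) → glued σs x ≡ σs i · x
  glued-part σs i {x} p with any? (λ i → x ∈? vertices (Gs i))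
  ... | no ¬p = contradiction (i , p) ¬p
  ... | yes (j , q) with i ≟ j
  ...   | yes refl = refl
  ...   | no i≢j = trans (terminal-fixed σs (≢-sym i≢j) q p) (sym (terminal-fixed σs i≢j p q))

  glued-outside : (σs : PartAuts) → ∀ {x} → x ∉ vertices (⋃ Gs) → glued σs x ≡ x
  glued-outside σs {x} ¬p with any? (λ i → x ∈? vertices (Gs i))
  ... | yes (i , p) = contradiction (⋃-vertex⁺ Gs i p) ¬p
  ... | no _        = refl

  glued-inverse : (σs τs : PartAuts) → (∀ i {x} → σs i · (τs i · x) ≡ x) →
                  ∀ x → glued σs (glued τs x) ≡ x
  glued-inverse σs τs inv x with x ∈? vertices (⋃ Gs)
  ... | no ¬p = trans (cong (glued σs) (glued-outside τs ¬p)) (glued-outside σs ¬p)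
  ... | yes p with ⋃-vertex⁻ Gs p
  ...   | i , q = trans (cong (glued σs) (glued-part τs i q))
                    (trans (glued-part σs i (aut-vertex (τs i) q)) (inv i))

  glued-adj : (σs : PartAuts) → ∀ {x y} → Adj (⋃ Gs) x y → Adj (⋃ Gs) (glued σs x) (glued σs y)
  glued-adj σs a with ⋃-adj⁻ Gs a
  ... | i , b = subst₂ (Adj (⋃ Gs)) (sym (glued-part σs i (adj-vertex (Gs i) b)))
                  (sym (glued-part σs i (adj-vertexʳ (Gs i) b))) (⋃-adj⁺ Gs i (aut-adj (σs i) b))

  glued-aut : PartAuts → Autₒᵣ (⋃ Gs) s t
  glued-aut σs = mkAut
    (permutation (glued σs) (glued τs)
      (glued-inverse σs τs λ i → inverseʳ (Autₒᵣ.perm (σs i)))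
      (glued-inverse τs σs λ i → inverseˡ (Autₒᵣ.perm (σs i))))
    (glued-outside σs) (glued-adj σs) (glued-adj τs)
    (subst (λ c → glued σs c ≡ c) source
      (trans (glued-part σs zero (Half.u∈ (forward zero))) (Autₒᵣ.fix-u (σs zero))))
    (subst (λ c → glued σs c ≡ c) target
      (trans (glued-part σs _ (Half.v∈ (forward _))) (Autₒᵣ.fix-v (σs _))))
    where
    τs : PartAuts
    τs i = inverse (σs i)

  -- Near trees of a serial composition

  NearTreeUnions : Pred (Graph n) 0ℓ
  NearTreeUnions = OneNearTreeUnions (λ i → ST (Gs i)) (λ i → NT (Gs i))

  parts-spanning : ∀ {j} {F : Fin (2 + m) → Graph n} → NT (Gs j) (F j) →
                   (∀ i → i ≢ j → ST (Gs i) (F i)) → ∀ i → Spanning (F i) (Gs i)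
  parts-spanning {j} near trees i with i ≟ j
  ... | yes refl = nt-spanning near
  ... | no i≢j   = st-spanning (trees i i≢j)

  nt-decompose : ∀ {A} → NT (⋃ Gs) A → NearTreeUnions A
  nt-decompose (T , tree , u , v , uv , refl) =
    -- The edge is deleted in every part, so that deletion commutes with the union; outside the part
    -- `j` containing it, this changes nothing.
    j , (λ i → deleteEdge (T ↾ Gs i) u v)
      , (T ↾ Gs j , restrict-tree tree j , u , v , ↾-adj⁺ T (Gs j) uv uvⱼ , refl)
      , (λ i i≢j → subst (ST (Gs i))
          (sym (delete-nonedge (T ↾ Gs i) u v λ a → i≢j (uv-part (proj₂ (↾-adj⁻ T (Gs i) a)))))
          (restrict-tree tree i))
      , trans (cong (λ H → deleteEdge H u v) (⋃-↾ Gs T (st-spanning tree)))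
          (delete-⋃ (λ i → T ↾ Gs i) u v)
    where
    part = ⋃-adj⁻ Gs (IsSubgraph.adj-⊆ (ST.subgraph tree) uv)
    j = proj₁ part
    uvⱼ = proj₂ part
    uv-part : ∀ {i} → Adj (Gs i) u v → i ≡ j
    uv-part {i} a = edge-part (adj-vertex (Gs i) a) (adj-vertexʳ (Gs i) a) uvⱼ

  nt-compose : ∀ {A} → NearTreeUnions A → NT (⋃ Gs) A
  nt-compose (j , F , (Tⱼ , tree , u , v , uv , Fⱼ≡) , trees , refl) =
    ⋃ T , ⋃-tree treeᵢ , u , v , ⋃-adj⁺ T j (subst (λ H → Adj H u v) (sym T-at) uv) ,
    trans (⋃-cong F≡) (sym (delete-⋃ T u v))
    where
    T : Fin (2 + m) → Graph n
    -- The near tree at `j` is replaced by the tree it came from, which gives a spanning tree of the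
    -- whole.
    T = updateAt F j (const Tⱼ)
    T-at : T j ≡ Tⱼ
    T-at = updateAt-updates j F
    T-off : ∀ {i} → i ≢ j → T i ≡ F i
    T-off i≢j = updateAt-minimal _ j F i≢j
    treeᵢ : ∀ i → ST (Gs i) (T i)
    treeᵢ i with i ≟ j
    ... | yes refl = subst (ST (Gs i)) (sym T-at) tree
    ... | no i≢j   = subst (ST (Gs i)) (sym (T-off i≢j)) (trees i i≢j)
    uv-part : ∀ {i} → Adj (T i) u v → i ≡ j
    uv-part {i} a = let b = IsSubgraph.adj-⊆ (ST.subgraph (treeᵢ i)) a in
      edge-part (adj-vertex (Gs i) b) (adj-vertexʳ (Gs i) b) (IsSubgraph.adj-⊆ (ST.subgraph tree) uv)
    F≡ : ∀ i → F i ≡ deleteEdge (T i) u v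
    F≡ i with i ≟ j
    ... | yes refl = trans Fⱼ≡ (cong (λ H → deleteEdge H u v) (sym T-at))
    ... | no i≢j   = trans (sym (T-off i≢j)) (sym (delete-nonedge (T i) u v (i≢j ∘ uv-part)))

-- Reachability in series-parallel graphs

edge-half : {G : Graph n} {s t : Fin n} → s ≢ t → (∀ {x} → x ∈ vertices G → x ≡ s ⊎ x ≡ t) →
            Adj G s t → Half G s t
edge-half {G = G} s≢t ends st = record
  { u∈ = adj-vertex G st ; v∈ = adj-vertexʳ G st ; u≢v = s≢t ; reach = reach ; avoid = avoid }
  where
  reach : ∀ {w} → w ∈ vertices G → Star (Adj G) w _
  reach p with ends p
  ... | inj₁ refl = st ◅ ε
  ... | inj₂ refl = ε
  avoid : ∀ {w} → w ∈ vertices G → w ≢ _ → Walk G (_≢ _) w _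
  avoid p w≢s with ends p
  ... | inj₁ refl = contradiction refl w≢s
  ... | inj₂ refl = ε

-- The chain read upwards from the first part gives one orientation, and read downwards from the
-- last part the other.
serial-halves : {G : Graph n} {s t : Fin n} {Gs : Fin (2 + m) → Graph n} {ss ts : Fin (2 + m) → Fin n} →
                IsSerialComposition G s t Gs ss ts →
                (∀ i → Half (Gs i) (ss i) (ts i) × Half (Gs i) (ts i) (ss i)) →
                Half G s t × Half G t s
serial-halves {m = m} {G} {s} {t} {Gs} C parts =
  subst₂ (λ G s → Half G s t) (sym union) source (Chain.chain-half up zero zero-least) ,
  subst₂ (λ G t → Half G t s) (sym union) target (Chain.chain-half down (fromℕ (1 + m)) last-least)
  where
  open IsSerialComposition C
  open Serial C (proj₁ ∘ parts) (proj₂ ∘ parts)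
  zero-least : ∀ {n} (l : Fin (suc n)) → zero ≡ l ⊎ zero {n} < l
  zero-least zero    = inj₁ refl
  zero-least (suc l) = inj₂ (s≤s ℕ.z≤n)
  last-least : ∀ {n} (l : Fin (suc n)) → fromℕ n ≡ l ⊎ fromℕ n > l
  last-least {zero}  zero = inj₁ refl
  last-least {suc n} zero = inj₂ (s≤s ℕ.z≤n)
  last-least {suc n} (suc l) with last-least l
  ... | inj₁ refl = inj₁ refl
  ... | inj₂ p    = inj₂ (s≤s p)

parallel-half : {Gs : Fin (2 + m) → Graph n} {s t : Fin n} →
                (∀ i → Half (Gs i) s t) → Half (⋃ Gs) s t
parallel-half {Gs = Gs} h = record
  { u∈    = ⋃-vertex⁺ Gs zero (H.u∈ zero)
  ; v∈    = ⋃-vertex⁺ Gs zero (H.v∈ zero)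
  ; u≢v   = H.u≢v zero
  ; reach = λ p → let i , q = ⋃-vertex⁻ Gs p in Star.map (⋃-adj⁺ Gs i) (H.reach i q)
  ; avoid = λ p w≢ → let i , q = ⋃-vertex⁻ Gs p
                     in Star.map (λ (a , b) → ⋃-adj⁺ Gs i a , b) (H.avoid i q w≢)
  }
  where module H i = Half (h i)

sp-halves : {G : Graph n} {s t : Fin n} → SeriesParallel G s t → Half G s t × Half G t s
sp-halves {G = G} {s} {t} (edge s≢t V≡ st) =
  edge-half s≢t ends st , edge-half (≢-sym s≢t) (Sum.swap ∘ ends) (adj-sym G st)
  where
  ends : ∀ {x} → x ∈ vertices G → x ≡ s ⊎ x ≡ t
  ends {x} p = Sum.map (x∈⁅y⁆⇒x≡y _) (x∈⁅y⁆⇒x≡y _) (x∈p∪q⁻ _ _ (subst (x ∈_) V≡ p))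
sp-halves (serial Gs ss ts C parts) = serial-halves C λ i → sp-halves (parts i)
sp-halves {s = s} {t} (parallel Gs C parts) =
  subst (λ G → Half G s t × Half G t s) (sym (IsParallelComposition.union C))
    (parallel-half (λ i → proj₁ (sp-halves (parts i))) ,
     parallel-half (λ i → proj₂ (sp-halves (parts i))))

-- Orbit representatives

orbit-unique : {H : Graph n} {u v : Fin n} {𝒫 𝒮 : Pred (Graph n) 0ℓ} → ExactlyOnePerOrbit H u v 𝒫 𝒮 →
               ∀ {A B B′} → 𝒫 A → 𝒮 B → SameOrbit H u v A B → 𝒮 B′ → SameOrbit H u v A B′ → B ≡ B′
orbit-unique E {A} a b σ b′ σ′ =
  let _ , _ , unique = ExactlyOnePerOrbit.exactly-one E A a
  in trans (sym (unique (b , σ))) (unique (b′ , σ′))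

module _ {s t : Fin n} {Gs : Fin (2 + m) → Graph n} {ss ts : Fin (2 + m) → Fin n}
         (S : IsSerialSuperedge (⋃ Gs) s t Gs ss ts)
         {𝒯 𝒩 : Fin (2 + m) → Pred (Graph n) 0ℓ}
         (tree-reps : ∀ i → ExactlyOnePerOrbit (Gs i) (ss i) (ts i) (ST (Gs i)) (𝒯 i))
         (near-reps : ∀ i → ExactlyOnePerOrbit (Gs i) (ss i) (ts i) (NT (Gs i)) (𝒩 i)) where

  private
    open IsSerialSuperedge S
    open Serial composition (proj₁ ∘ sp-halves ∘ parts) (proj₂ ∘ sp-halves ∘ parts)
    open Gluing gluing using (parts-unique)
    module TR i = ExactlyOnePerOrbit (tree-reps i)
    module NR i = ExactlyOnePerOrbit (near-reps i)

    -- Two implications rather than a case split on `i ≟ j`: they are read off directly from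
    -- `OneNearTreeUnions` and can be transported along an equation between values of `j`.
    Rep : (j i : Fin (2 + m)) → Pred (Graph n) 0ℓ
    Rep j i B = (i ≡ j → 𝒩 i B) × (i ≢ j → 𝒯 i B)

    rep-spanning : ∀ j i {B} → Rep j i B → Spanning B (Gs i)
    rep-spanning j i (near , tree) with i ≟ j
    ... | yes i≡j = nt-spanning (NR.consists-of i (near i≡j))
    ... | no i≢j  = st-spanning (TR.consists-of i (tree i≢j))

    toRep : ∀ {j} {F : Fin (2 + m) → Graph n} →
            𝒩 j (F j) → (∀ i → i ≢ j → 𝒯 i (F i)) → ∀ i → Rep j i (F i)
    toRep near trees i = (λ { refl → near }) , trees i

    module _ {j : Fin (2 + m)} {F : Fin (2 + m) → Graph n}
             (near : NT (Gs j) (F j)) (trees : ∀ i → i ≢ j → ST (Gs i) (F i)) where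

      pick : ∀ i → ∃ λ B → Rep j i B × SameOrbit (Gs i) (ss i) (ts i) (F i) B
      pick i with i ≟ j
      ... | yes refl = let B , (b , σ) , _ = NR.exactly-one i (F i) near
                       in B , ((λ _ → b) , λ i≢i → contradiction refl i≢i) , σ
      ... | no i≢j   = let B , (b , σ) , _ = TR.exactly-one i (F i) (trees i i≢j)
                       in B , ((λ i≡j → contradiction i≡j i≢j) , λ _ → b) , σ

      rep-unique : ∀ i {B B′} → Rep j i B → SameOrbit (Gs i) (ss i) (ts i) (F i) B →
                   Rep j i B′ → SameOrbit (Gs i) (ss i) (ts i) (F i) B′ → B ≡ B′
      rep-unique i (b , c) σ (b′ , c′) σ′ with i ≟ j
      ... | yes refl = orbit-unique (near-reps i) near (b refl) σ (b′ refl) σ′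
      ... | no i≢j   = orbit-unique (tree-reps i) (trees i i≢j) (c i≢j) σ (c′ i≢j) σ′

      -- Restricting `σ` to the parts writes `⋃ F` as the union of the images of the `F′ i`, and
      -- `parts-unique` compares the two unions part by part.
      orbit-parts : ∀ {j′} {F′ : Fin (2 + m) → Graph n} → (∀ i → Rep j′ i (F′ i)) →
                    SameOrbit (⋃ Gs) s t (⋃ F) (⋃ F′) →
                    ∀ i → SameOrbit (Gs i) (ss i) (ts i) (F i) (F′ i)
      orbit-parts {j′} {F′} reps (σ , eq) i = τ i ,
        parts-unique F (λ i → image (Autₒᵣ.perm (τ i)) (F′ i)) (parts-spanning near trees)
          (λ i → image-spanning (τ i) (spanning i))
          (trans eq (image-⋃ (Autₒᵣ.perm σ) τ (λ i → proj₂ (restrict σ i)) (proj₁ ∘ spanning))) i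
        where
        τ : PartAuts
        τ i = proj₁ (restrict σ i)
        spanning : ∀ i → Spanning (F′ i) (Gs i)
        spanning i = rep-spanning j′ i (reps i)

      -- Near trees are disconnected and trees connected, so an orbit determines j.
      near-index : ∀ {j′} {F′ : Fin (2 + m) → Graph n} → (∀ i → Rep j′ i (F′ i)) →
                   (∀ i → SameOrbit (Gs i) (ss i) (ts i) (F i) (F′ i)) → j′ ≡ j
      near-index {j′} {F′} reps orbits = decidable-stable (j′ ≟ j) λ j′≢j →
        let σ , eq = orbits j′ in
        nt-disconnected (NR.consists-of j′ (proj₁ (reps j′) refl))
          (image-connected⁻ (Autₒᵣ.perm σ) (F′ j′)
            (subst Connected eq (ST.connected (trees j′ j′≢j))))

      representative : ∃[ B ] (OneNearTreeUnions 𝒯 𝒩 B × SameOrbit (⋃ Gs) s t (⋃ F) B) ×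
                       (∀ {B′} → OneNearTreeUnions 𝒯 𝒩 B′ × SameOrbit (⋃ Gs) s t (⋃ F) B′ → B ≡ B′)
      representative = ⋃ B ,
        ((j , B , proj₁ (rep j) refl , (λ i → proj₂ (rep i)) , refl) ,
         (glued-aut σs , trans (⋃-cong (λ i → proj₂ (orbit i)))
           (sym (image-⋃ (Autₒᵣ.perm (glued-aut σs)) σs (glued-part σs)
             λ i → proj₁ (rep-spanning j i (rep i)))))) ,
        unique
        where
        B : Fin (2 + m) → Graph n
        B i = proj₁ (pick i)
        rep : ∀ i → Rep j i (B i)
        rep i = proj₁ (proj₂ (pick i))
        orbit : ∀ i → SameOrbit (Gs i) (ss i) (ts i) (F i) (B i)
        orbit i = proj₂ (proj₂ (pick i))
        σs : PartAuts
        σs i = proj₁ (orbit i)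
        unique : ∀ {B′} → OneNearTreeUnions 𝒯 𝒩 B′ × SameOrbit (⋃ Gs) s t (⋃ F) B′ → ⋃ B ≡ B′
        -- A competitor comes with its own index `j′`. Its parts are first shown to lie in the
        -- orbits of the `F i`; then `near-index` identifies `j′` with `j`, and uniqueness applies
        -- in each part.
        unique ((j′ , F′ , near′ , trees′ , refl) , σ) = ⋃-cong λ i →
          rep-unique i (rep i) (orbit i)
            (subst (λ j → Rep j i (F′ i)) (near-index reps′ orbits′) (reps′ i)) (orbits′ i)
          where
          reps′ : ∀ i → Rep j′ i (F′ i)
          reps′ = toRep near′ trees′
          orbits′ : ∀ i → SameOrbit (Gs i) (ss i) (ts i) (F i) (F′ i)
          orbits′ = orbit-parts reps′ σ

  serial-near-trees : ExactlyOnePerOrbit (⋃ Gs) s t (NT (⋃ Gs)) (OneNearTreeUnions 𝒯 𝒩)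
  serial-near-trees = record
    { consists-of = λ (j , F , near , trees , eq) → nt-compose
        (j , F , NR.consists-of j near , (λ i i≢j → TR.consists-of i (trees i i≢j)) , eq)
    ; exactly-one = λ A nt → let j , F , near , trees , eq = nt-decompose nt in
        subst (λ A → ∃[ B ] (OneNearTreeUnions 𝒯 𝒩 B × SameOrbit (⋃ Gs) s t A B) ×
                       (∀ {B′} → OneNearTreeUnions 𝒯 𝒩 B′ × SameOrbit (⋃ Gs) s t A B′ → B ≡ B′))
          (sym eq) (representative near trees)
    }

theorem5p5 : ∀ {n m : ℕ} (G : Graph n) (s t : Fin n)
    (Gs : Fin (2 + m) → Graph n) (ss ts : Fin (2 + m) → Fin n) →
    IsSerialSuperedge G s t Gs ss ts →
    (∀ i → NonParallel (Gs i) (ss i) (ts i)) →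
    (𝒯 𝒩 : Fin (2 + m) → Pred (Graph n) 0ℓ) →
    (∀ i → ExactlyOnePerOrbit (Gs i) (ss i) (ts i) (ST (Gs i)) (𝒯 i)) →
    (∀ i → ExactlyOnePerOrbit (Gs i) (ss i) (ts i) (NT (Gs i)) (𝒩 i)) →
    ExactlyOnePerOrbit G s t (NT G) (OneNearTreeUnions 𝒯 𝒩)
theorem5p5 G s t Gs ss ts S _ 𝒯 𝒩 tree-reps near-reps =
  subst (λ G → ExactlyOnePerOrbit G s t (NT G) (OneNearTreeUnions 𝒯 𝒩)) (sym union)
    (serial-near-trees (subst (λ G → IsSerialSuperedge G s t Gs ss ts) union S) tree-reps near-reps)
  where open IsSerialComposition (IsSerialSuperedge.composition S)
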